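{- Let $G$ be a finite simple disconnected graph with no isolated vertices. Then the matching complex $M(G)$ is a connected graph if and only if $G$ has exactly two connected components, each of which is either a $K_3$ or a star graph.
   Context: A matching in $G$ is a set of edges no two of which share an endpoint. $M(G)$ is the simplicial complex whose faces are all matchings of $G$ (its vertices are the edges of $G$). "$M(G)$ is a connected graph" means that $M(G)$ has dimension at most one (no matching of size 3 exists in $G$) and is connected. The star graph $S_n$ ($n\ge1$) has $n+1$ vertices: one center joined to $n$ leaves. -}

module Defs where

open import Data.Bool.Base using (Bool; true; false; not; T)
open import Data.Empty using (⊥-elim)
open import Data.Fin.Base using (Fin; zero; suc; _<_)
open import Data.Fin.Properties using (_≟_)
open import Data.Fin.Subset using (Subset; Nonempty) renaming (_∈_ to _∈ₛ_)
open import Data.List.Base using (List; []; _∷_; [_]; length)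
open import Data.List.Membership.Propositional using (_∈_)
open import Data.List.Relation.Binary.Subset.Propositional using (_⊆_)
open import Data.List.Relation.Unary.Any using (here)
open import Data.List.Relation.Unary.Unique.Propositional using (Unique)
open import Data.Nat.Base using (ℕ; suc; _≤_; _≥_)
open import Data.Product.Base using (Σ; ∃; ∃₂; _×_; _,_; proj₁)
open import Data.Sum.Base using (_⊎_)
open import Function.Base using (_on_)
open import Function.Bundles using (_↔_; _⇔_; module Inverse)
open import Level using (0ℓ)
open import Relation.Binary.Construct.Closure.ReflexiveTransitive using (Star)
open import Relation.Binary.Core using (Rel)
open import Relation.Binary.PropositionalEquality using (_≡_; _≢_; refl; sym; trans)
open import Relation.Nullary.Decidable.Core using (⌊_⌋; yes; no)
open import Relation.Nullary.Negation.Core using (¬_)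

-- Adjacency is Bool-valued so that there is at most one edge between
-- any two vertices; a finite graph is a  Graph (Fin n).
record Graph (V : Set) : Set where
  field
    adj        : V → V → Bool
    symmetric  : ∀ u v → T (adj u v) → T (adj v u)
    loopless   : ∀ v → ¬ T (adj v v)

  Adj : Rel V 0ℓ
  Adj u v = T (adj u v)

  Reachable : Rel V 0ℓ
  Reachable = Star Adj

  Connected : Set
  Connected = ∀ u v → Reachable u v

  -- In particular the graph without vertices is not disconnected.
  Disconnected : Set
  Disconnected = ¬ Connected

  Isolated : V → Set
  Isolated v = ∀ u → ¬ Adj v u

  NoIsolatedVertices : Set
  NoIsolatedVertices = ∀ v → ¬ Isolated v

open Graph public

record _≅_ {V W : Set} (G : Graph V) (H : Graph W) : Set where
  field
    bijection : V ↔ W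
    preserves : ∀ u v →
      adj G u v ≡ adj H (Inverse.to bijection u) (Inverse.to bijection v)

infix 4 _≅_

complete : ∀ n → Graph (Fin n)
complete n = record
  { adj       = λ u v → not ⌊ u ≟ v ⌋
  ; symmetric = symm
  ; loopless  = irr
  }
  where
  symm : ∀ (u v : Fin n) → T (not ⌊ u ≟ v ⌋) → T (not ⌊ v ≟ u ⌋)
  symm u v p with u ≟ v | v ≟ u
  ... | no _   | no _   = _
  ... | no u≢v | yes q  = u≢v (sym q)

  irr : ∀ (v : Fin n) → ¬ T (not ⌊ v ≟ v ⌋)
  irr v p with v ≟ v
  ... | no v≢v = v≢v refl

-- The centre is  zero; the n leaves are the successors.
star : ∀ n → Graph (Fin (suc n))
star n = record { adj = a ; symmetric = symm ; loopless = irr }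
  where
  a : Fin (suc n) → Fin (suc n) → Bool
  a zero    zero    = false
  a zero    (suc _) = true
  a (suc _) zero    = true
  a (suc _) (suc _) = false

  symm : ∀ u v → T (a u v) → T (a v u)
  symm zero    (suc _) _ = _
  symm (suc _) zero    _ = _

  irr : ∀ v → ¬ T (a v v)
  irr zero    ()
  irr (suc _) ()

induced : ∀ {n} → Graph (Fin n) → (S : Subset n) → Graph (Σ (Fin n) (_∈ₛ S))
induced G S = record
  { adj       = adj G on proj₁
  ; symmetric = λ u v → symmetric G (proj₁ u) (proj₁ v)
  ; loopless  = λ v → loopless G (proj₁ v)
  }

-- Vertex sets of connected components: the classes of reachability.
IsComponent : ∀ {n} → Graph (Fin n) → Subset n → Set
IsComponent G C = Nonempty C × (∀ {u} → u ∈ₛ C → ∀ v → v ∈ₛ C ⇔ Reachable G u v)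

ExactlyTwoComponents : ∀ {n} → Graph (Fin n) → Set
ExactlyTwoComponents G = ∃₂ λ C D →
  IsComponent G C × IsComponent G D × C ≢ D ×
  (∀ E → IsComponent G E → E ≡ C ⊎ E ≡ D)

IsK₃ : ∀ {V} → Graph V → Set
IsK₃ G = G ≅ complete 3

IsStar : ∀ {V} → Graph V → Set
IsStar G = ∃ λ m → m ≥ 1 × G ≅ star m

-- A list stands for the finite set of its entries: closure under _⊆_
-- makes Face insensitive to order and repetition.
record SimplicialComplex (V : Set) : Set₁ where
  field
    Face        : List V → Set
    empty       : Face []
    vertex      : ∀ v → Face [ v ]
    down-closed : ∀ {σ τ} → σ ⊆ τ → Face τ → Face σ

  -- A face with k elements has dimension k − 1.
  Dimension≤ : ℕ → Set
  Dimension≤ d = ∀ σ → Face σ → Unique σ → length σ ≤ suc d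

  -- Connectedness of a complex is that of its 1-skeleton.
  ConnectedComplex : Set
  ConnectedComplex = ∀ u v → Star (λ x y → Face (x ∷ y ∷ [])) u v

  IsConnectedGraph : Set
  IsConnectedGraph = Dimension≤ 1 × ConnectedComplex

open SimplicialComplex public

-- Ordering the endpoints makes each unordered edge occur exactly once.
record Edge {n} (G : Graph (Fin n)) : Set where
  constructor edge
  field
    {src tgt} : Fin n
    src<tgt   : src < tgt
    adjacent  : Adj G src tgt

  Endpoint : Fin n → Set
  Endpoint v = v ≡ src ⊎ v ≡ tgt

open Edge public

ShareEndpoint : ∀ {n} {G : Graph (Fin n)} → Rel (Edge G) 0ℓ
ShareEndpoint e f = ∃ λ v → Endpoint e v × Endpoint f v

IsMatching : ∀ {n} {G : Graph (Fin n)} → List (Edge G) → Set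
IsMatching M = ∀ {e f} → e ∈ M → f ∈ M → e ≢ f → ¬ ShareEndpoint e f

matchingComplex : ∀ {n} (G : Graph (Fin n)) → SimplicialComplex (Edge G)
matchingComplex G = record
  { Face        = IsMatching
  ; empty       = λ ()
  ; vertex      = λ { _ (here p) (here q) e≢f → ⊥-elim (e≢f (trans p (sym q))) }
  ; down-closed = λ σ⊆τ m e∈σ f∈σ → m (σ⊆τ e∈σ) (σ⊆τ f∈σ)
  }

{-# OPTIONS --safe #-}

-- Two edges in different components are always disjoint.  Hence three components
-- give a matching of size 3, and so do two disjoint edges of one component
-- together with an edge of another one; conversely, if there are two components
-- and the edges of each meet pairwise, then among three edges two meet, and any
-- two edges are joined through an edge of the other component.  It remains to see
-- that a connected graph whose edges meet pairwise is K₃ or a star: either the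
-- ends of a fixed edge have a common neighbour, or one of them is a centre.
module Submission where

open import Data.Bool.Base using (T; true)
open import Data.Bool.Properties using (T?; T-≡; ⇔→≡)
open import Data.Empty using (⊥; ⊥-elim)
open import Data.Fin.Base using (Fin; zero; suc)
open import Data.Fin.Patterns using (0F; 1F; 2F)
open import Data.Fin.Properties using (_≟_; any?; all?; ¬∀⟶∃¬; <-cmp)
open import Data.Fin.Subset using (Subset) renaming (_∈_ to _∈ₛ_)
open import Data.Fin.Subset.Properties using (⊆-antisym)
open import Data.List.Base using (List; []; _∷_; allFin; filter; length; lookup)
open import Data.List.Membership.Propositional using (_∈_)
open import Data.List.Membership.Propositional.Properties
  using (∈-allFin; ∈-filter⁺; ∈-filter⁻; ∈-lookup)
open import Data.List.Relation.Unary.All as All using ([]; _∷_)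
open import Data.List.Relation.Unary.AllPairs using (AllPairs; []; _∷_)
open import Data.List.Relation.Unary.Any using (here; there; index)
open import Data.List.Relation.Unary.Any.Properties using (lookup-index)
open import Data.List.Relation.Unary.Unique.Propositional using (Unique)
open import Data.List.Relation.Unary.Unique.Propositional.Properties using (allFin⁺; filter⁺)
open import Data.Nat.Base using (ℕ; suc; _≥_; z≤n; s≤s)
open import Data.Product.Base using (Σ; ∃; _×_; _,_; proj₁; proj₂)
open import Data.Sum.Base as Sum using (_⊎_; inj₁; inj₂; [_,_]′)
open import Data.Vec.Base using (tabulate)
open import Data.Vec.Properties using (lookup∘tabulate; []=⇒lookup; lookup⇒[]=)
open import Data.Vec.Properties.WithK using ([]=-irrelevant)
open import Function.Base using (_∘_)
open import Function.Bundles using (_⇔_; mk⇔; mk↔ₛ′; module Equivalence; module Injection)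
open import Function.Properties.Inverse using (↔⇒↣)
open import Function.Definitions using (Injective)
open import Level using (0ℓ)
open import Relation.Binary.Construct.Closure.ReflexiveTransitive
  using (Star; ε; _◅_; _◅◅_; reverse)
open import Relation.Binary.Core using (Rel)
open import Relation.Binary.Definitions using (Decidable; tri<; tri≈; tri>)
open import Relation.Binary.PropositionalEquality
  using (_≡_; _≢_; refl; sym; trans; cong; cong₂; subst)
open import Relation.Nullary.Decidable
  using (Dec; yes; no; does; _⊎-dec_; _×-dec_; _→-dec_; ¬?; from-yes; map′; dec-true
        ; decidable-stable)
open import Relation.Nullary.Negation using (¬_; contradiction)
open import Defs

-- Decidability of reachability

module _ {n} (R : Rel (Fin n) 0ℓ) (R? : Decidable R) where

  -- Paths all of whose inner vertices lie in the list (Warshall's algorithm).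
  Via : List (Fin n) → Fin n → Fin n → Set
  Via []       u v = u ≡ v ⊎ R u v
  Via (x ∷ xs) u v = Via xs u v ⊎ (Via xs u x × Via xs x v)

  via? : ∀ xs u v → Dec (Via xs u v)
  via? []       u v = (u ≟ v) ⊎-dec R? u v
  via? (x ∷ xs) u v = via? xs u v ⊎-dec (via? xs u x ×-dec via? xs x v)

  via⇒star : ∀ xs {u v} → Via xs u v → Star R u v
  via⇒star []       (inj₁ refl)    = ε
  via⇒star []       (inj₂ r)       = r ◅ ε
  via⇒star (x ∷ xs) (inj₁ p)       = via⇒star xs p
  via⇒star (x ∷ xs) (inj₂ (p , q)) = via⇒star xs p ◅◅ via⇒star xs q

  via-base : ∀ xs {u v} → u ≡ v ⊎ R u v → Via xs u v
  via-base []       p = p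
  via-base (x ∷ xs) p = inj₁ (via-base xs p)

  -- Induction on the list. If `w` is its head, both paths are cut at `w`, keeping the part up to
  -- the first visit and the part after the last one. If `w` comes later and both paths pass through
  -- the head `x`, the detour from `x` to `w` and back to `x` is dropped.
  via-trans : ∀ {xs u w v} → w ∈ xs → Via xs u w → Via xs w v → Via xs u v
  via-trans {x ∷ xs} (here refl) p q = inj₂ (into p , out q)
    where
    into : ∀ {u} → Via (x ∷ xs) u x → Via xs u x
    into (inj₁ p)       = p
    into (inj₂ (p , _)) = p
    out : ∀ {v} → Via (x ∷ xs) x v → Via xs x v
    out (inj₁ q)       = q
    out (inj₂ (_ , q)) = q
  via-trans (there w∈) (inj₁ p)       (inj₁ q)       = inj₁ (via-trans w∈ p q)
  via-trans (there w∈) (inj₁ p)       (inj₂ (q , r)) = inj₂ (via-trans w∈ p q , r)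
  via-trans (there w∈) (inj₂ (p , q)) (inj₁ r)       = inj₂ (p , via-trans w∈ q r)
  via-trans (there w∈) (inj₂ (p , _)) (inj₂ (_ , r)) = inj₂ (p , r)

  star⇒via : ∀ {u v} → Star R u v → Via (allFin n) u v
  star⇒via ε        = via-base (allFin n) (inj₁ refl)
  star⇒via (r ◅ rs) =
    via-trans (∈-allFin _) (via-base (allFin n) (inj₂ r)) (star⇒via rs)

  star? : Decidable (Star R)
  star? u v = map′ (via⇒star (allFin n)) star⇒via (via? (allFin n) u v)

-- Subsets cut out by decidable predicates

module _ {n} {P : Fin n → Set} (P? : ∀ v → Dec (P v)) where

  comprehension : Subset n
  comprehension = tabulate (does ∘ P?)

  ∈-comprehension : ∀ v → v ∈ₛ comprehension ⇔ P v
  ∈-comprehension v = mk⇔ to from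
    where
    to : v ∈ₛ comprehension → P v
    to v∈ with P? v | trans (sym (lookup∘tabulate (does ∘ P?) v)) ([]=⇒lookup v∈)
    ... | yes p | _ = p
    from : P v → v ∈ₛ comprehension
    from p = lookup⇒[]= v _ (trans (lookup∘tabulate (does ∘ P?) v) (dec-true (P? v) p))

T-injective : ∀ {x y} → (T x → T y) → (T y → T x) → x ≡ y
T-injective f g = ⇔→≡ (mk⇔ (to T-≡ ∘ f ∘ from T-≡) (to T-≡ ∘ g ∘ from T-≡))
  where open Equivalence

-- Graphs with pairwise intersecting edges

-- Formulated for pairs of vertices instead of `Edge`, whose ordered endpoints exist only over
-- `Fin n`: in this form it also applies to induced subgraphs and can be carried along isomorphisms.
Meet : ∀ {V : Set} → V → V → V → V → Set
Meet a b c d = (a ≡ c ⊎ a ≡ d) ⊎ (b ≡ c ⊎ b ≡ d)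

meet? : ∀ {n} (a b c d : Fin n) → Dec (Meet a b c d)
meet? a b c d = ((a ≟ c) ⊎-dec (a ≟ d)) ⊎-dec ((b ≟ c) ⊎-dec (b ≟ d))

meet-map : ∀ {V W : Set} (f : V → W) {a b c d} → Meet a b c d → Meet (f a) (f b) (f c) (f d)
meet-map f = Sum.map (Sum.map (cong f) (cong f)) (Sum.map (cong f) (cong f))

meet-reflect : ∀ {V W : Set} {f : V → W} → Injective _≡_ _≡_ f →
  ∀ {a b c d} → Meet (f a) (f b) (f c) (f d) → Meet a b c d
meet-reflect inj = Sum.map (Sum.map inj inj) (Sum.map inj inj)

-- The link between the two sides of the equivalence: K₃ and the stars have this property, and it is
-- what a matching complex of dimension at most one forces on each component.
Intersecting : ∀ {V} → Graph V → Set
Intersecting G = ∀ a b c d → Adj G a b → Adj G c d → Meet a b c d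

star-intersecting : ∀ m → Intersecting (star m)
star-intersecting m zero    (suc _) zero    (suc _) _ _ = inj₁ (inj₁ refl)
star-intersecting m zero    (suc _) (suc _) zero    _ _ = inj₁ (inj₂ refl)
star-intersecting m (suc _) zero    zero    (suc _) _ _ = inj₂ (inj₁ refl)
star-intersecting m (suc _) zero    (suc _) zero    _ _ = inj₂ (inj₂ refl)

K₃-intersecting : Intersecting (complete 3)
K₃-intersecting = from-yes (all? λ a → all? λ b → all? λ c → all? λ d →
  T? (adj (complete 3) a b) →-dec (T? (adj (complete 3) c d) →-dec meet? a b c d))

≅-intersecting : ∀ {V W} {G : Graph V} {H : Graph W} → G ≅ H → Intersecting H → Intersecting G
≅-intersecting iso int a b c d p q =
  meet-reflect (Injection.injective (↔⇒↣ bijection))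
    (int _ _ _ _ (subst T (preserves a b) p) (subst T (preserves c d) q))
  where open _≅_ iso

-- Membership in a `Subset` is proof-irrelevant, so a vertex of an induced subgraph is determined by
-- its underlying vertex.
vertex-injective : ∀ {n} {S : Subset n} → Injective _≡_ _≡_ (proj₁ {A = Fin n} {B = _∈ₛ S})
vertex-injective {x = _ , p} {_ , q} refl = cong (_ ,_) ([]=-irrelevant p q)

lookup-injective : ∀ {A : Set} {xs : List A} → Unique xs → Injective _≡_ _≡_ (lookup xs)
lookup-injective (_ ∷ _)   {zero}  {zero}  _ = refl
lookup-injective {xs = _ ∷ xs} (p ∷ _) {zero}  {suc j} e =
  contradiction e (All.lookup p (∈-lookup j))
lookup-injective {xs = _ ∷ xs} (p ∷ _) {suc i} {zero}  e =
  contradiction (sym e) (All.lookup p (∈-lookup i))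
lookup-injective (_ ∷ u)   {suc i} {suc j} e = cong suc (lookup-injective u e)

-- Recognising K₃ and stars as induced subgraphs

module _ {n} (G : Graph (Fin n)) where

  -- Reduces an isomorphism to an enumeration `f` of `S` without repetitions; its inverse is read
  -- off from `onto`.
  induced-≅ : ∀ {S k} (H : Graph (Fin k)) (f : Fin k → Fin n) →
    Injective _≡_ _≡_ f → (∀ i → f i ∈ₛ S) → (∀ {v} → v ∈ₛ S → ∃ λ i → f i ≡ v) →
    (∀ i j → adj G (f i) (f j) ≡ adj H i j) → induced G S ≅ H
  induced-≅ {S} {k} H f f-inj f∈S onto pres = record
    { bijection = mk↔ₛ′ to (λ i → f i , f∈S i)
        -- `onto` promises only some index with value `f i`; injectivity identifies it with `i`.
        (λ i → f-inj (proj₂ (onto (f∈S i))))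
        (λ (v , v∈) → vertex-injective (proj₂ (onto v∈)))
    ; preserves = λ (u , u∈) (v , v∈) →
        trans (sym (cong₂ (adj G) (proj₂ (onto u∈)) (proj₂ (onto v∈)))) (pres _ _)
    }
    where
    to : Σ (Fin n) (_∈ₛ S) → Fin k
    to (_ , v∈) = proj₁ (onto v∈)

  adj⇒≢ : ∀ {u v} → Adj G u v → u ≢ v
  adj⇒≢ p refl = loopless G _ p

  adj-sym : ∀ {u v} → Adj G u v → Adj G v u
  adj-sym = symmetric G _ _

  adj? : ∀ u v → Dec (Adj G u v)
  adj? u v = T? (adj G u v)

  reachable? : Decidable (Reachable G)
  reachable? = star? (Adj G) adj?

  reach-sym : ∀ {u v} → Reachable G u v → Reachable G v u
  reach-sym = reverse adj-sym

  triangle-isK₃ : ∀ {S a b c} → a ∈ₛ S → b ∈ₛ S → c ∈ₛ S →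
    Adj G a b → Adj G a c → Adj G b c →
    (∀ {v} → v ∈ₛ S → v ≡ a ⊎ v ≡ b ⊎ v ≡ c) → IsK₃ (induced G S)
  triangle-isK₃ {S} {a} {b} {c} a∈ b∈ c∈ ab ac bc only =
    induced-≅ (complete 3) f f-inj f∈S (onto ∘ only) pres
    where
    f : Fin 3 → Fin n
    f 0F = a
    f 1F = b
    f 2F = c
    f∈S : ∀ i → f i ∈ₛ S
    f∈S 0F = a∈
    f∈S 1F = b∈
    f∈S 2F = c∈
    f-inj : Injective _≡_ _≡_ f
    f-inj {0F} {0F} _ = refl
    f-inj {0F} {1F} e = contradiction e (adj⇒≢ ab)
    f-inj {0F} {2F} e = contradiction e (adj⇒≢ ac)
    f-inj {1F} {0F} e = contradiction (sym e) (adj⇒≢ ab)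
    f-inj {1F} {1F} _ = refl
    f-inj {1F} {2F} e = contradiction e (adj⇒≢ bc)
    f-inj {2F} {0F} e = contradiction (sym e) (adj⇒≢ ac)
    f-inj {2F} {1F} e = contradiction (sym e) (adj⇒≢ bc)
    f-inj {2F} {2F} _ = refl
    onto : ∀ {v} → v ≡ a ⊎ v ≡ b ⊎ v ≡ c → ∃ λ i → f i ≡ v
    onto (inj₁ e)        = 0F , sym e
    onto (inj₂ (inj₁ e)) = 1F , sym e
    onto (inj₂ (inj₂ e)) = 2F , sym e
    edge≡ : ∀ {u v} → Adj G u v → adj G u v ≡ true
    edge≡ = Equivalence.to T-≡
    loop≡ : ∀ v → adj G v v ≡ adj (complete 3) 0F 0F
    loop≡ v = T-injective (loopless G v) (λ ())
    pres : ∀ i j → adj G (f i) (f j) ≡ adj (complete 3) i j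
    pres 0F 0F = loop≡ a
    pres 0F 1F = edge≡ ab
    pres 0F 2F = edge≡ ac
    pres 1F 0F = edge≡ (adj-sym ab)
    pres 1F 1F = loop≡ b
    pres 1F 2F = edge≡ bc
    pres 2F 0F = edge≡ (adj-sym ac)
    pres 2F 1F = edge≡ (adj-sym bc)
    pres 2F 2F = loop≡ c

  -- The neighbours of `c`, listed without repetition, number the leaves. The edge `cd` supplies the
  -- one leaf that `IsStar` demands.
  centre-isStar : ∀ {S c d} → c ∈ₛ S → Adj G c d → (∀ {v} → Adj G c v → v ∈ₛ S) →
    (∀ {v} → v ∈ₛ S → v ≡ c ⊎ Adj G c v) →
    (∀ {u v} → Adj G c u → Adj G c v → ¬ Adj G u v) → IsStar (induced G S)
  centre-isStar {S} {c} {d} c∈ cd nbr∈ only indep =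
    length leaves , positive (∈-leaves cd) ,
    induced-≅ (star (length leaves)) f f-inj f∈S (onto ∘ only) pres
    where
    leaves : List (Fin n)
    leaves = filter (adj? c) (allFin n)
    ∈-leaves : ∀ {v} → Adj G c v → v ∈ leaves
    ∈-leaves p = ∈-filter⁺ (adj? c) (∈-allFin _) p
    positive : ∀ {v} {xs : List (Fin n)} → v ∈ xs → length xs ≥ 1
    positive (here _)  = s≤s z≤n
    positive (there _) = s≤s z≤n
    leaf : ∀ i → Adj G c (lookup leaves i)
    leaf i = proj₂ (∈-filter⁻ (adj? c) {xs = allFin n} (∈-lookup i))
    f : Fin (suc (length leaves)) → Fin n
    f zero    = c
    f (suc i) = lookup leaves i
    f-inj : Injective _≡_ _≡_ f
    f-inj {zero}  {zero}  _ = refl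
    f-inj {zero}  {suc j} e = contradiction e (adj⇒≢ (leaf j))
    f-inj {suc i} {zero}  e = contradiction (sym e) (adj⇒≢ (leaf i))
    f-inj {suc i} {suc j} e =
      cong suc (lookup-injective (filter⁺ (adj? c) (allFin⁺ n)) e)
    f∈S : ∀ i → f i ∈ₛ S
    f∈S zero    = c∈
    f∈S (suc i) = nbr∈ (leaf i)
    onto : ∀ {v} → v ≡ c ⊎ Adj G c v → ∃ λ i → f i ≡ v
    onto (inj₁ e) = zero , sym e
    onto (inj₂ p) = suc (index (∈-leaves p)) , sym (lookup-index (∈-leaves p))
    pres : ∀ i j → adj G (f i) (f j) ≡ adj (star _) i j
    pres zero    zero    = T-injective (loopless G c) (λ ())
    pres zero    (suc j) = Equivalence.to T-≡ (leaf j)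
    pres (suc i) zero    = Equivalence.to T-≡ (adj-sym (leaf i))
    pres (suc i) (suc j) = T-injective (indep (leaf i) (leaf j)) (λ ())

  -- Classification of intersecting graphs

  module _ (noIsolated : NoIsolatedVertices G) where

    neighbour : ∀ v → ∃ (Adj G v)
    neighbour v with any? (adj? v)
    ... | yes p = p
    ... | no ¬p = contradiction (λ u p → ¬p (u , p)) (noIsolated v)

    -- Every vertex of `S` lies on an edge, which stays in `S` by `closed` and must meet the fixed
    -- edge `ab`. This keeps `S` in one piece and leaves few places for the vertex.
    classify : ∀ {S a} → a ∈ₛ S → (∀ {u v} → u ∈ₛ S → Adj G u v → v ∈ₛ S) →
      Intersecting (induced G S) → IsK₃ (induced G S) ⊎ IsStar (induced G S)
    classify {S} {a} a∈ closed int = result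
      where
      b : Fin n
      b = proj₁ (neighbour a)
      ab : Adj G a b
      ab = proj₂ (neighbour a)
      b∈ : b ∈ₛ S
      b∈ = closed a∈ ab

      meet : ∀ {u v x y} → u ∈ₛ S → x ∈ₛ S → Adj G u v → Adj G x y → Meet u v x y
      meet u∈ x∈ p q =
        meet-map proj₁ (int (_ , u∈) (_ , closed u∈ p) (_ , x∈) (_ , closed x∈ q) p q)

      triangle : ∀ {c} → Adj G a c → Adj G b c → IsK₃ (induced G S)
      triangle {c} ac bc = triangle-isK₃ a∈ b∈ (closed a∈ ac) ab ac bc only
        where
        -- The edge `vw` meets all three sides of the triangle. No vertex lies on all three, so `w`
        -- alone cannot account for this and `v` is a corner.
        only : ∀ {v} → v ∈ₛ S → v ≡ a ⊎ v ≡ b ⊎ v ≡ c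
        only {v} v∈ with neighbour v
        ... | w , vw with meet v∈ a∈ vw ab | meet v∈ a∈ vw ac | meet v∈ b∈ vw bc
        ... | inj₁ (inj₁ e) | _ | _ = inj₁ e
        ... | inj₁ (inj₂ e) | _ | _ = inj₂ (inj₁ e)
        ... | _ | inj₁ (inj₁ e) | _ = inj₁ e
        ... | _ | inj₁ (inj₂ e) | _ = inj₂ (inj₂ e)
        ... | _ | _ | inj₁ (inj₁ e) = inj₂ (inj₁ e)
        ... | _ | _ | inj₁ (inj₂ e) = inj₂ (inj₂ e)
        ... | inj₂ (inj₁ refl) | inj₂ _ | inj₂ (inj₁ e) = contradiction e (adj⇒≢ ab)
        ... | inj₂ (inj₁ refl) | inj₂ _ | inj₂ (inj₂ e) = contradiction e (adj⇒≢ ac)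
        ... | inj₂ (inj₂ refl) | inj₂ (inj₁ e) | inj₂ _ = contradiction (sym e) (adj⇒≢ ab)
        ... | inj₂ (inj₂ refl) | inj₂ (inj₂ e) | inj₂ _ = contradiction e (adj⇒≢ bc)

      module _ (no-triangle : ∀ {c} → Adj G a c → ¬ Adj G b c) where

        -- An edge `uv` between two neighbours of `a` would have to meet `ab`: at `a` this makes a
        -- loop, at `b` a triangle over `ab`.
        independent-a : ∀ {u v} → Adj G a u → Adj G a v → ¬ Adj G u v
        independent-a au av uv with meet (closed a∈ au) a∈ uv ab
        ... | inj₁ (inj₁ refl) = loopless G _ au
        ... | inj₁ (inj₂ refl) = no-triangle av uv
        ... | inj₂ (inj₁ refl) = loopless G _ av
        ... | inj₂ (inj₂ refl) = no-triangle au (adj-sym uv)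

        independent-b : ∀ {u v} → Adj G b u → Adj G b v → ¬ Adj G u v
        independent-b bu bv uv with meet (closed b∈ bu) a∈ uv ab
        ... | inj₁ (inj₁ refl) = no-triangle uv bv
        ... | inj₁ (inj₂ refl) = loopless G _ bu
        ... | inj₂ (inj₁ refl) = no-triangle (adj-sym uv) bu
        ... | inj₂ (inj₂ refl) = loopless G _ bv

        -- The edge `vy` meets both `ab` and `aw`. If `v` is none of `a`, `b`, `w`, then `y` lies on
        -- both edges, and since `w` differs from `b` this leaves only `a`.
        centre-a : ∀ {w} → Adj G a w → w ≢ b → ∀ {v} → v ∈ₛ S → v ≡ a ⊎ Adj G a v
        centre-a aw w≢b {v} v∈ with neighbour v
        ... | y , vy with meet v∈ a∈ vy ab | meet v∈ a∈ vy aw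
        ... | inj₁ (inj₁ e)    | _                = inj₁ e
        ... | inj₁ (inj₂ refl) | _                = inj₂ ab
        ... | inj₂ (inj₁ refl) | _                = inj₂ (adj-sym vy)
        ... | inj₂ (inj₂ _)    | inj₁ (inj₁ e)    = inj₁ e
        ... | inj₂ (inj₂ _)    | inj₁ (inj₂ refl) = inj₂ aw
        ... | inj₂ (inj₂ _)    | inj₂ (inj₁ refl) = inj₂ (adj-sym vy)
        ... | inj₂ (inj₂ refl) | inj₂ (inj₂ e)    = contradiction (sym e) w≢b

        -- The edge `vy` meets `ab`. The one case that needs `pendant` is `y` equal to `a`: then `v`
        -- is a neighbour of `a`, hence `b`.
        centre-b : (∀ {w} → Adj G a w → w ≡ b) → ∀ {v} → v ∈ₛ S → v ≡ b ⊎ Adj G b v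
        centre-b pendant {v} v∈ with neighbour v
        ... | y , vy with meet v∈ a∈ vy ab
        ... | inj₁ (inj₁ refl) = inj₂ (adj-sym ab)
        ... | inj₁ (inj₂ e)    = inj₁ e
        ... | inj₂ (inj₁ refl) = inj₁ (pendant (adj-sym vy))
        ... | inj₂ (inj₂ refl) = inj₂ (adj-sym vy)

        isStar : IsStar (induced G S)
        -- A second neighbour of `a` makes `a` the centre; otherwise `b` is one. A single edge falls
        -- under the second case.
        isStar with any? (λ w → adj? a w ×-dec ¬? (w ≟ b))
        ... | yes (w , aw , w≢b) =
          centre-isStar a∈ ab (closed a∈) (centre-a aw w≢b) independent-a
        ... | no none =
          centre-isStar b∈ (adj-sym ab) (closed b∈) (centre-b pendant) independent-b
          where
          pendant : ∀ {w} → Adj G a w → w ≡ b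
          pendant {w} aw = decidable-stable (w ≟ b) (λ w≢b → none (w , aw , w≢b))

      result : IsK₃ (induced G S) ⊎ IsStar (induced G S)
      result with any? (λ c → adj? a c ×-dec adj? b c)
      ... | yes (_ , ac , bc) = inj₁ (triangle ac bc)
      ... | no none           = inj₂ (isStar (λ ac bc → none (_ , ac , bc)))

  -- Components

  component : Fin n → Subset n
  component v = comprehension (reachable? v)

  ∈-component : ∀ {u v} → v ∈ₛ component u ⇔ Reachable G u v
  ∈-component {u} {v} = ∈-comprehension (reachable? u) v

  component-isComponent : ∀ v → IsComponent G (component v)
  component-isComponent v =
    (v , from ∈-component ε) ,
    λ u∈ w → mk⇔ (λ w∈ → reach-sym (to ∈-component u∈) ◅◅ to ∈-component w∈)
                 (λ r → from ∈-component (to ∈-component u∈ ◅◅ r))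
    where open Equivalence

  component-unique : ∀ {C D u v} → IsComponent G C → IsComponent G D →
    u ∈ₛ C → v ∈ₛ D → Reachable G u v → C ≡ D
  component-unique (_ , C⇔) (_ , D⇔) u∈ v∈ r = ⊆-antisym
    (λ {w} w∈ → from (D⇔ v∈ w) (reach-sym r ◅◅ to (C⇔ u∈ w) w∈))
    (λ {w} w∈ → from (C⇔ u∈ w) (r ◅◅ to (D⇔ v∈ w) w∈))
    where open Equivalence

  component-≡⇒reachable : ∀ {u v} → component u ≡ component v → Reachable G u v
  component-≡⇒reachable {v = v} e = to ∈-component (subst (v ∈ₛ_) (sym e) (from ∈-component ε))
    where open Equivalence

  component-pigeonhole : ExactlyTwoComponents G → ∀ u v w →
    Reachable G u v ⊎ Reachable G u w ⊎ Reachable G v w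
  component-pigeonhole (C , D , _ , _ , _ , only) u v w
    with only _ (component-isComponent u) | only _ (component-isComponent v)
       | only _ (component-isComponent w)
  ... | inj₁ p | inj₁ q | _      = inj₁ (component-≡⇒reachable (trans p (sym q)))
  ... | inj₂ p | inj₂ q | _      = inj₁ (component-≡⇒reachable (trans p (sym q)))
  ... | inj₁ p | inj₂ _ | inj₁ q = inj₂ (inj₁ (component-≡⇒reachable (trans p (sym q))))
  ... | inj₂ p | inj₁ _ | inj₂ q = inj₂ (inj₁ (component-≡⇒reachable (trans p (sym q))))
  ... | inj₁ _ | inj₂ p | inj₂ q = inj₂ (inj₂ (component-≡⇒reachable (trans p (sym q))))
  ... | inj₂ _ | inj₁ p | inj₁ q = inj₂ (inj₂ (component-≡⇒reachable (trans p (sym q))))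

  component-closed : ∀ {C} → IsComponent G C → ∀ {u v} → u ∈ₛ C → Adj G u v → v ∈ₛ C
  component-closed (_ , C⇔) u∈ p = Equivalence.from (C⇔ u∈ _) (p ◅ ε)

  -- Reachability is decidable on finitely many vertices, so the negation in `Disconnected` yields
  -- an actual pair.
  unreachable : Disconnected G → ∃ λ u → ∃ λ v → ¬ Reachable G u v
  unreachable disc with ¬∀⟶∃¬ n _ (λ u → all? (reachable? u)) disc
  ... | u , ¬r = u , ¬∀⟶∃¬ n _ (reachable? u) ¬r

  -- The matching complex

  Disjoint : Rel (Edge G) 0ℓ
  Disjoint e f = ¬ ShareEndpoint {G = G} e f

  disjoint-sym : ∀ e f → Disjoint e f → Disjoint f e
  disjoint-sym e f d (v , p , q) = d (v , q , p)

  disjoint⇒≢ : ∀ e f → Disjoint e f → e ≢ f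
  disjoint⇒≢ e _ d refl = d (src e , inj₁ refl , inj₁ refl)

  allPairs⇒matching : ∀ {σ} → AllPairs Disjoint σ → IsMatching σ
  allPairs⇒matching (p ∷ ps) (here refl) (here refl) e≢f = contradiction refl e≢f
  allPairs⇒matching (p ∷ ps) (here refl) (there f∈)  _   = All.lookup p f∈
  allPairs⇒matching (p ∷ ps) {e} {f} (there e∈) (here refl) _ = disjoint-sym f e (All.lookup p e∈)
  allPairs⇒matching (p ∷ ps) (there e∈)  (there f∈)  e≢f = allPairs⇒matching ps e∈ f∈ e≢f

  no-3-matching : Dimension≤ (matchingComplex G) 1 → ∀ e f g →
    Disjoint e f → Disjoint e g → Disjoint f g → ⊥
  no-3-matching dim e f g ef eg fg
    with dim (e ∷ f ∷ g ∷ [])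
      (allPairs⇒matching ((ef ∷ eg ∷ []) ∷ (fg ∷ []) ∷ [] ∷ []))
      ((disjoint⇒≢ e f ef ∷ disjoint⇒≢ e g eg ∷ []) ∷ (disjoint⇒≢ f g fg ∷ []) ∷ [] ∷ [])
  ... | s≤s (s≤s ())

  _↝_ : Rel (Edge G) 0ℓ
  e ↝ f = Face (matchingComplex G) (e ∷ f ∷ [])

  disjoint⇒↝ : ∀ e f → Disjoint e f → e ↝ f
  disjoint⇒↝ e f d = allPairs⇒matching ((d ∷ []) ∷ [] ∷ [])

  -- The order on `Fin n` may force `src` to be `v`, so the endpoints are recorded only up to
  -- exchange.
  adj⇒edge : ∀ {u v} → Adj G u v → Σ (Edge G) λ e → ∀ {x} → Endpoint e x → x ≡ u ⊎ x ≡ v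
  adj⇒edge {u} {v} p with <-cmp u v
  ... | tri< u<v _ _    = edge u<v p , λ ends → ends
  ... | tri≈ _ refl _   = contradiction p (loopless G u)
  ... | tri> _ _ v<u    = edge v<u (adj-sym p) , λ { (inj₁ e) → inj₂ e ; (inj₂ e) → inj₁ e }

  -- Lets `src e` stand for the component of `e` in all later comparisons of components.
  endpoint-reachable : ∀ (e : Edge G) {v} → Endpoint e v → Reachable G (src e) v
  endpoint-reachable e (inj₁ refl) = ε
  endpoint-reachable e (inj₂ refl) = adjacent e ◅ ε

  separated⇒disjoint : ∀ e f → ¬ Reachable G (src e) (src f) → Disjoint e f
  separated⇒disjoint e f ¬r (_ , p , q) =
    ¬r (endpoint-reachable e p ◅◅ reach-sym (endpoint-reachable f q))

  meet⇒share : ∀ (e f : Edge G) → Meet (src e) (tgt e) (src f) (tgt f) → ShareEndpoint e f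
  meet⇒share e f (inj₁ (inj₁ p)) = _ , inj₁ refl , inj₁ p
  meet⇒share e f (inj₁ (inj₂ p)) = _ , inj₁ refl , inj₂ p
  meet⇒share e f (inj₂ (inj₁ p)) = _ , inj₂ refl , inj₁ p
  meet⇒share e f (inj₂ (inj₂ p)) = _ , inj₂ refl , inj₂ p

  -- Edges in different components

  module _ (disc : Disconnected G) (noIsolated : NoIsolatedVertices G) where

    -- The source of an edge at `v` may be `v` or its neighbour, hence reachability in place of
    -- equality.
    edgeNear : ∀ v → Σ (Edge G) λ e → Reachable G v (src e)
    edgeNear v with neighbour noIsolated v
    ... | w , vw with adj⇒edge vw
    ... | e , ends with ends (inj₁ refl)
    ... | inj₁ refl = e , ε
    ... | inj₂ refl = e , vw ◅ ε

    -- Of two vertices that cannot reach each other, at least one is out of reach from `v`.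
    otherComponent : ∀ v → ∃ λ w → ¬ Reachable G v w
    otherComponent v with unreachable disc
    ... | x , y , ¬xy with reachable? v x
    ... | no ¬vx = x , ¬vx
    ... | yes vx = y , λ vy → ¬xy (reach-sym vx ◅◅ vy)

    otherEdge : ∀ v → Σ (Edge G) λ e → ¬ Reachable G v (src e)
    otherEdge v with otherComponent v
    ... | w , ¬vw with edgeNear w
    ... | e , we = e , λ ve → ¬vw (ve ◅◅ reach-sym we)

    matching-connected : ConnectedComplex (matchingComplex G)
    matching-connected e f with reachable? (src e) (src f)
    ... | no ¬ef = disjoint⇒↝ e f (separated⇒disjoint e f ¬ef) ◅ ε
    ... | yes ef with otherEdge (src e)
    ... | g , ¬eg =
      disjoint⇒↝ e g (separated⇒disjoint e g ¬eg) ◅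
      disjoint⇒↝ g f (separated⇒disjoint g f λ gf → ¬eg (ef ◅◅ reach-sym gf)) ◅ ε

    -- Consequences of dimension at most one

    module _ (dim : Dimension≤ (matchingComplex G) 1) where

      -- If `w` were in a third component, edges chosen near `u`, `v` and `w` would form a matching
      -- of size three.
      two-classes : ∀ {u v} → ¬ Reachable G u v → ∀ w → Reachable G u w ⊎ Reachable G v w
      two-classes {u} {v} ¬uv w with reachable? u w | reachable? v w
      ... | yes uw | _      = inj₁ uw
      ... | no _   | yes vw = inj₂ vw
      ... | no ¬uw | no ¬vw = ⊥-elim (no-3-matching dim (near u) (near v) (near w)
        (apart ¬uv) (apart ¬uw) (apart ¬vw))
        where
        near : Fin n → Edge G
        near x = proj₁ (edgeNear x)
        apart : ∀ {x y} → ¬ Reachable G x y →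
          Disjoint (near x) (near y)
        apart {x} {y} ¬xy with edgeNear x | edgeNear y
        ... | e , xe | f , yf =
          separated⇒disjoint e f λ ef → ¬xy (xe ◅◅ ef ◅◅ reach-sym yf)

      exactlyTwo : ExactlyTwoComponents G
      exactlyTwo with unreachable disc
      ... | u , v , ¬uv =
        component u , component v , component-isComponent u , component-isComponent v ,
        distinct , exhaust
        where
        open Equivalence
        distinct : component u ≢ component v
        distinct e = ¬uv (component-≡⇒reachable e)
        exhaust : ∀ E → IsComponent G E → E ≡ component u ⊎ E ≡ component v
        exhaust E isE@((w , w∈) , _) with two-classes ¬uv w
        ... | inj₁ uw = inj₁ (component-unique isE (component-isComponent u) w∈
                (from ∈-component ε) (reach-sym uw))
        ... | inj₂ vw = inj₂ (component-unique isE (component-isComponent v) w∈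
                (from ∈-component ε) (reach-sym vw))

      -- Two edges of `C` without a common end would form a matching of size three with an edge `g`
      -- outside `C`.
      component-intersecting : ∀ {C} → IsComponent G C → Intersecting (induced G C)
      component-intersecting {C} isC (a , a∈) (b , b∈) (c , c∈) (d , d∈) ab cd
        with adj⇒edge ab | adj⇒edge cd | otherEdge a
      ... | e , e-ends | f , f-ends | g , ¬ag with meet? a b c d
      ... | yes m = meet-reflect vertex-injective m
      ... | no ¬m = ⊥-elim (no-3-matching dim e f g ef (apart e e-src) (apart f f-src))
        where
        reach : ∀ {x} → x ∈ₛ C → Reachable G a x
        reach {x} x∈ = Equivalence.to (proj₂ isC a∈ x) x∈
        -- The source of `e` or `f` may be either end of the given adjacency, so both ends are
        -- placed in the component of `a`.
        within : ∀ {x y z} → y ∈ₛ C → z ∈ₛ C → x ≡ y ⊎ x ≡ z → Reachable G a x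
        within y∈ z∈ (inj₁ refl) = reach y∈
        within y∈ z∈ (inj₂ refl) = reach z∈
        e-src : Reachable G a (src e)
        e-src = within a∈ b∈ (e-ends (inj₁ refl))
        f-src : Reachable G a (src f)
        f-src = within c∈ d∈ (f-ends (inj₁ refl))
        apart : ∀ h → Reachable G a (src h) → Disjoint h g
        apart h ah = separated⇒disjoint h g λ hg → ¬ag (ah ◅◅ hg)
        ef : Disjoint e f
        ef (x , p , q) with e-ends p | f-ends q
        ... | inj₁ refl | inj₁ r = ¬m (inj₁ (inj₁ r))
        ... | inj₁ refl | inj₂ r = ¬m (inj₁ (inj₂ r))
        ... | inj₂ refl | inj₁ r = ¬m (inj₂ (inj₁ r))
        ... | inj₂ refl | inj₂ r = ¬m (inj₂ (inj₂ r))

  -- From two intersecting components to dimension at most one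

  module _ (two : ExactlyTwoComponents G)
           (shape : ∀ C → IsComponent G C → Intersecting (induced G C)) where

    -- Both edges live in the subgraph induced on the component of `src e`, where `shape` makes them
    -- meet.
    same-component-share : ∀ (e f : Edge G) → Reachable G (src e) (src f) → ShareEndpoint e f
    same-component-share e f r = meet⇒share e f (meet-map proj₁ (shape C isC
      (src e , here∈ ε) (tgt e , here∈ (adjacent e ◅ ε))
      (src f , here∈ r) (tgt f , here∈ (r ◅◅ adjacent f ◅ ε))
      (adjacent e) (adjacent f)))
      where
      C : Subset n
      C = component (src e)
      isC : IsComponent G C
      isC = component-isComponent (src e)
      here∈ : ∀ {v} → Reachable G (src e) v → v ∈ₛ C
      here∈ = Equivalence.from ∈-component

    matching-dimension : Dimension≤ (matchingComplex G) 1
    matching-dimension []              m u = z≤n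
    matching-dimension (_ ∷ [])        m u = s≤s z≤n
    matching-dimension (_ ∷ _ ∷ [])    m u = s≤s (s≤s z≤n)
    -- The first three entries already give a contradiction: two of their sources lie in one
    -- component, so these two distinct edges of a matching share an endpoint.
    matching-dimension (e ∷ f ∷ g ∷ σ) m ((e≢f ∷ e≢g ∷ _) ∷ (f≢g ∷ _) ∷ _)
      with component-pigeonhole two (src e) (src f) (src g)
    ... | inj₁ r        = contradiction (same-component-share e f r)
                            (m (here refl) (there (here refl)) e≢f)
    ... | inj₂ (inj₁ r) = contradiction (same-component-share e g r)
                            (m (here refl) (there (there (here refl))) e≢g)
    ... | inj₂ (inj₂ r) = contradiction (same-component-share f g r)
                            (m (there (here refl)) (there (there (here refl))) f≢g)

lemma3p4 : ∀ {n : ℕ} (G : Graph (Fin n)) → Disconnected G → NoIsolatedVertices G →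
    IsConnectedGraph (matchingComplex G) ⇔
    (ExactlyTwoComponents G ×
    (∀ C → IsComponent G C → IsK₃ (induced G C) ⊎ IsStar (induced G C)))
lemma3p4 G disc noIso = mk⇔
  (λ (dim , _) → exactlyTwo G disc noIso dim , λ { C isC@((_ , c∈) , _) →
    classify G noIso c∈ (component-closed G isC)
      (component-intersecting G disc noIso dim isC) })
  (λ (two , shape) →
    matching-dimension G two (λ C isC →
      [ (λ iso → ≅-intersecting iso K₃-intersecting)
      , (λ (m , _ , iso) → ≅-intersecting iso (star-intersecting m))
      ]′ (shape C isC)) ,
    matching-connected G disc noIso)
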